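{- For every permutation graph $G$, we have $\chi_{\mathrm{pcf}}(G)\le 3\chi(G)$.
   Context: Graphs are finite and simple. A permutation graph is an intersection graph of line segments having their two endpoints on two parallel lines, one on each (equivalently, the comparability graph of a poset of dimension at most two). $\chi(G)$ is the chromatic number. A proper conflict-free coloring of $G$ is a proper vertex coloring in which, for every non-isolated vertex $v$, some color appears exactly once in the open neighborhood $N(v)$. $\chi_{\mathrm{pcf}}(G)$ is the least $k$ such that $G$ has a proper conflict-free coloring with $k$ colors. -}

module Defs where

open import Data.Nat.Base using (ℕ; zero; suc; _≤_; _<_)
open import Data.Nat.Properties using (≤-refl; ≮⇒≥; m<1+n⇒m<n∨m≡n)
open import Data.Fin.Base using (Fin; finToFun; funToFin)
open import Data.Fin.Properties using (_≟_; any?; all?; finToFun-funToFin)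
open import Data.Product using (Σ; ∃; ∃!; _×_; _,_; proj₁; proj₂)
open import Data.Sum.Base using (_⊎_; inj₁; inj₂)
open import Function.Base using (id)
open import Function.Bundles using (_⇔_)
open import Level using (0ℓ)
open import Relation.Binary.Core using (Rel)
open import Relation.Binary.Definitions using (Symmetric; Irreflexive; Decidable)
open import Relation.Binary.Structures using (IsPartialOrder; IsTotalOrder)
open import Relation.Binary.PropositionalEquality
  using (_≡_; _≢_; _≗_; refl; sym; trans)
open import Relation.Nullary using (Dec; ¬_; contradiction)
open import Relation.Nullary.Decidable using (map′; yes; no; ¬?; _×-dec_; _→-dec_)

record Graph : Set₁ where
  field
    order  : ℕ
  Vertex : Set
  Vertex = Fin order
  field
    Adj    : Rel Vertex 0ℓ
    symm   : Symmetric Adj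
    irrefl : Irreflexive _≡_ Adj
    adj?   : Decidable Adj

-- Order dimension at most d: _⊑_ is the intersection of d linear orders.
-- The orders need not be distinct, which is why this says "at most".
DimensionAtMost : {n : ℕ} → ℕ → Rel (Fin n) 0ℓ → Set₁
DimensionAtMost {n} d _⊑_ =
  Σ (Fin d → Rel (Fin n) 0ℓ) λ L →
    (∀ i → IsTotalOrder _≡_ (L i)) ×
    (∀ x y → x ⊑ y ⇔ (∀ i → L i x y))

IsComparabilityGraphOf : (G : Graph) → Rel (Graph.Vertex G) 0ℓ → Set
IsComparabilityGraphOf G _⊑_ =
  ∀ u v → Graph.Adj G u v ⇔ (u ≢ v × (u ⊑ v ⊎ v ⊑ u))

-- Permutation graphs as comparability graphs of posets of dimension at most
-- two.  In terms of segments between two parallel lines, the two linear orders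
-- are the left-to-right order of the endpoints on one line and the
-- right-to-left order of the endpoints on the other.
IsPermutationGraph : Graph → Set₁
IsPermutationGraph G =
  Σ (Rel (Graph.Vertex G) 0ℓ) λ _⊑_ →
    IsPartialOrder _≡_ _⊑_ × DimensionAtMost 2 _⊑_ × IsComparabilityGraphOf G _⊑_

module _ (G : Graph) where
  open Graph G

  Coloring : ℕ → Set
  Coloring k = Vertex → Fin k

  IsProper : {k : ℕ} → Coloring k → Set
  IsProper c = ∀ u v → Adj u v → c u ≢ c v

  NonIsolated : Vertex → Set
  NonIsolated v = ∃ λ u → Adj v u

  AppearsOnceAround : {k : ℕ} → Coloring k → Vertex → Fin k → Set
  AppearsOnceAround c v a = ∃! _≡_ λ u → Adj v u × c u ≡ a

  IsConflictFree : {k : ℕ} → Coloring k → Set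
  IsConflictFree c = ∀ v → NonIsolated v → ∃ λ a → AppearsOnceAround c v a

  Colorable : ℕ → Set
  Colorable k = Σ (Coloring k) IsProper

  PCFColorable : ℕ → Set
  PCFColorable k = Σ (Coloring k) λ c → IsProper c × IsConflictFree c

IsLeast : (ℕ → Set) → ℕ → Set
IsLeast P k = P k × (∀ j → P j → k ≤ j)

private
  search : (P : ℕ → Set) → (∀ k → Dec (P k)) → (n : ℕ) →
           (∃ (IsLeast P)) ⊎ (∀ j → j < n → ¬ P j)
  search P P? zero = inj₂ λ _ ()
  search P P? (suc n) with search P P? n
  ... | inj₁ found = inj₁ found
  ... | inj₂ none with P? n
  ...   | yes p = inj₁ (n , p , λ j q → ≮⇒≥ λ j<n → none j j<n q)
  ...   | no ¬p = inj₂ below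
    where
    below : ∀ j → j < suc n → ¬ P j
    below j j<1+n q with m<1+n⇒m<n∨m≡n j<1+n
    ... | inj₁ j<n  = none j j<n q
    ... | inj₂ refl = ¬p q

  least : (P : ℕ → Set) → (∀ k → Dec (P k)) → ∃ P → ∃ (IsLeast P)
  least P P? (n , p) with search P P? (suc n)
  ... | inj₁ found = found
  ... | inj₂ none  = contradiction p (none n ≤-refl)

  ∃-function? : {m k : ℕ} (Q : (Fin m → Fin k) → Set) →
                (∀ {f g} → f ≗ g → Q f → Q g) →
                (∀ f → Dec (Q f)) → Dec (Σ (Fin m → Fin k) Q)
  ∃-function? Q resp Q? =
    map′ (λ (i , q) → finToFun i , q)
         (λ (f , q) → funToFin f , resp (λ x → sym (finToFun-funToFin f x)) q)
         (any? λ i → Q? (finToFun i))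

module _ (G : Graph) where
  open Graph G

  private
    proper-resp : ∀ {k} {c d : Coloring G k} → c ≗ d → IsProper G c → IsProper G d
    proper-resp c≗d p u v a e = p u v a (trans (c≗d u) (trans e (sym (c≗d v))))

    conflictFree-resp : ∀ {k} {c d : Coloring G k} → c ≗ d →
                        IsConflictFree G c → IsConflictFree G d
    conflictFree-resp c≗d cf v ni with cf v ni
    ... | a , u , (adj , e) , unique =
      a , u , (adj , trans (sym (c≗d u)) e) ,
      λ (adj′ , e′) → unique (adj′ , trans (c≗d _) e′)

    proper? : ∀ {k} (c : Coloring G k) → Dec (IsProper G c)
    proper? c = all? λ u → all? λ v → adj? u v →-dec ¬? (c u ≟ c v)

    appearsOnce? : ∀ {k} (c : Coloring G k) v a → Dec (AppearsOnceAround G c v a)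
    appearsOnce? c v a =
      any? λ u → (adj? v u ×-dec (c u ≟ a)) ×-dec
        map′ (λ f {w} → f w) (λ f w → f {w})
          (all? λ w → (adj? v w ×-dec (c w ≟ a)) →-dec (u ≟ w))

    conflictFree? : ∀ {k} (c : Coloring G k) → Dec (IsConflictFree G c)
    conflictFree? c = all? λ v → any? (adj? v) →-dec any? (appearsOnce? c v)

    id-proper : IsProper G id
    id-proper u v a e = irrefl e a

    id-conflictFree : IsConflictFree G id
    id-conflictFree v (u , a) = u , u , (a , refl) , λ (_ , e) → sym e

  χ-least : ∃ (IsLeast (Colorable G))
  χ-least = least (Colorable G)
    (λ k → ∃-function? (IsProper G) proper-resp proper?)
    (order , id , id-proper)

  χ-pcf-least : ∃ (IsLeast (PCFColorable G))
  χ-pcf-least = least (PCFColorable G)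
    (λ k → ∃-function? (λ c → IsProper G c × IsConflictFree G c)
      (λ c≗d (p , q) → proper-resp c≗d p , conflictFree-resp c≗d q)
      (λ c → proper? c ×-dec conflictFree? c))
    (order , id , id-proper , id-conflictFree)

  χ : ℕ
  χ = proj₁ χ-least

  χ-pcf : ℕ
  χ-pcf = proj₁ χ-pcf-least

{-# OPTIONS --safe #-}

-- With k = χ(G), colour the maximal elements of the poset with one class and the
-- others by rank: a chain has at most k elements, so this makes k antichains.
-- A vertex of rank r + 1 is above a non-maximal vertex of rank r, and all its
-- neighbours in that class are below it; a non-isolated minimal vertex is below
-- a maximal one.  Hence each class has to serve the vertices of a single
-- antichain, all of them from the same side.
--
-- Splitting one class into three colours suffices for this.  Take an
-- inclusion-minimal set P of points of the class that hits every neighbourhood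
-- to be served, and colour P alternately from left to right with two colours and
-- the rest with the third.  If p and q are two points of P of the same
-- colour in the neighbourhood of b, then some s in P lies between them; by
-- minimality s is the only point of P in some served neighbourhood, say that
-- of b′, and missing p and q forces b′ below b, contradicting that the served
-- vertices form an antichain.
module Submission where

open import Defs
open import Data.Bool.Base using (Bool; true; false; not; _xor_)
open import Data.Bool.Properties using (not-¬; not-distribˡ-xor; not-distribʳ-xor)
open import Data.Empty using (⊥)
open import Data.Fin.Base as Fin using (Fin; zero; suc; toℕ; fromℕ<; combine)
open import Data.Fin.Induction using (spo-noetherian)
open import Data.Fin.Properties
  using (_≟_; any?; all?; ¬∀⟶∃¬; combine-injective; pigeonhole; suc-injective;
         toℕ-fromℕ<; toℕ-injective)
open import Data.Fin.Subset using (Subset; _∈_; _⊂_; _-_; ⊤)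
open import Data.Fin.Subset.Induction using (⊂-wellFounded)
open import Data.Fin.Subset.Properties
  using (_∈?_; ∈⊤; x∈p⇒p-x⊂p; x∈p∧x≢y⇒x∈p-y)
open import Data.Nat.Base using (ℕ; zero; suc; _≤_; _<_; _*_; z≤n; s≤s; z<s; s<s)
open import Data.Nat.Properties using (n<1+n; n≤1+n; m<n⇒m<1+n; <-cmp)
open import Data.Product using (Σ; ∃; ∃-syntax; _×_; _,_; proj₁; proj₂; map₂)
open import Data.Sum.Base using (_⊎_; inj₁; inj₂)
open import Data.Unit.Base using (tt) renaming (⊤ to Unit)
open import Data.Vec.Functional using (Vector; foldr)
open import Function.Base using (_∘_; flip)
open import Function.Bundles using (Equivalence; _⇔_; mk⇔)
open import Induction.WellFounded using (Acc; acc)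
open import Level using (0ℓ)
open import Relation.Binary.Core using (Rel)
import Relation.Binary.Construct.Flip.EqAndOrd as Flip
import Relation.Binary.Construct.Intersection as Intersection
import Relation.Binary.Construct.NonStrictToStrict as ToStrict
open import Relation.Binary.Definitions as B using (tri<; tri≈; tri>)
open import Relation.Binary.PropositionalEquality
  using (_≡_; _≢_; refl; sym; trans; cong; cong₂; subst)
open import Relation.Binary.Structures using (IsStrictPartialOrder; IsStrictTotalOrder)
open import Relation.Nullary using (Dec; ¬_; contradiction; does; yes; no)
open import Relation.Nullary.Decidable
  using (_×-dec_; _→-dec_; ¬?; does-⇔; dec-true; dec-false; decidable-stable)
open import Relation.Unary using (Pred; Decidable)

-- Alternating two-colourings along a linear order.

parity : ∀ {n} → Vector Bool n → Bool
parity = foldr _xor_ false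

parity-cong : ∀ {n} {f g : Vector Bool n} → (∀ x → f x ≡ g x) → parity f ≡ parity g
parity-cong {zero}  f≗g = refl
parity-cong {suc n} f≗g = cong₂ _xor_ (f≗g zero) (parity-cong (f≗g ∘ suc))

parity-flip : ∀ {n} {f g : Vector Bool n} x → f x ≡ not (g x) →
              (∀ y → y ≢ x → f y ≡ g y) → parity f ≡ not (parity g)
parity-flip {g = g} zero e f≗g = trans
  (cong₂ _xor_ e (parity-cong λ y → f≗g (suc y) λ ()))
  (sym (not-distribˡ-xor (g zero) _))
parity-flip {g = g} (suc x) e f≗g = trans
  (cong₂ _xor_ (f≗g zero λ ())
    (parity-flip x e λ y y≢x → f≗g (suc y) (y≢x ∘ suc-injective)))
  (sym (not-distribʳ-xor (g zero) _))

module _ {n} {_<_ : Rel (Fin n) 0ℓ} (sto : IsStrictTotalOrder _≡_ _<_) (P : Subset n) where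
  open IsStrictTotalOrder sto using (compare; _<?_; irrefl) renaming (trans to <-trans)

  -- On `P` this is the alternating colouring from left to right, obtained without listing `P` in
  -- order.
  position-parity : Fin n → Bool
  position-parity v = parity λ u → does (u ∈? P ×-dec u <? v)

  -- With no point of `P` strictly between, the points of `P` before `q` would be those before `p`
  -- and `p` itself, so the parities would differ.
  position-parity-alternates : ∀ {p q} → p ∈ P → p < q →
    position-parity q ≡ position-parity p → ∃[ s ] (s ∈ P × p < s × s < q)
  position-parity-alternates {p} {q} p∈P p<q same
    with any? (λ s → s ∈? P ×-dec p <? s ×-dec s <? q)
  ... | yes between = between
  ... | no ¬between = contradiction (parity-flip p at-p off-p) (not-¬ same)
    where
    at-p : does (p ∈? P ×-dec p <? q) ≡ not (does (p ∈? P ×-dec p <? p))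
    at-p = trans (dec-true (p ∈? P ×-dec p <? q) (p∈P , p<q))
      (cong not (sym (dec-false (p ∈? P ×-dec p <? p) (irrefl refl ∘ proj₂))))

    off-p : ∀ u → u ≢ p → does (u ∈? P ×-dec u <? q) ≡ does (u ∈? P ×-dec u <? p)
    off-p u u≢p = does-⇔
      (mk⇔ to (map₂ λ u<p → <-trans u<p p<q))
      (u ∈? P ×-dec u <? q) (u ∈? P ×-dec u <? p)
      where
      to : u ∈ P × u < q → u ∈ P × u < p
      to (u∈P , u<q) with compare u p
      ... | tri< u<p _ _ = u∈P , u<p
      ... | tri≈ _ u≡p _ = contradiction u≡p u≢p
      ... | tri> _ _ p<u = contradiction (u , u∈P , p<u , u<q) ¬between

-- Irredundant transversals of a finite family of sets.

module _ {m n} {B : Pred (Fin m) 0ℓ} (B? : Decidable B)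
         {N : Fin m → Fin n → Set} (N? : ∀ b → Decidable (N b)) where

  Transversal : Subset n → Set
  Transversal P = ∀ b → B b → ∃[ a ] (a ∈ P × N b a)

  -- For a transversal this amounts to inclusion-minimality; the private set `N b` of each point is
  -- the form in which minimality is used.
  Irredundant : Subset n → Set
  Irredundant P = ∀ p → p ∈ P → ∃[ b ] (B b × N b p × (∀ q → q ∈ P → N b q → q ≡ p))

  private
    meets? : ∀ P b → Dec (B b → ∃[ a ] (a ∈ P × N b a))
    meets? P b = B? b →-dec any? λ a → a ∈? P ×-dec N? b a

    shrink : ∀ P → Acc _⊂_ P → Transversal P → ∃[ Q ] (Transversal Q × Irredundant Q)
    shrink P (acc rec) hits with any? (λ p → p ∈? P ×-dec all? (meets? (P - p)))
    ... | yes (p , p∈P , hits′) = shrink (P - p) (rec (x∈p⇒p-x⊂p p∈P)) hits′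
    ... | no ¬removable = P , hits , irredundant
      where
      irredundant : Irredundant P
      irredundant p p∈P
        -- A set of the family that `P` meets and `P - p` misses meets `P` in `p` alone.
        with b , ¬meets ← ¬∀⟶∃¬ m _ (meets? (P - p)) (λ hits′ → ¬removable (p , p∈P , hits′))
        = b , b∈B , subst (N b) (only a a∈P bNa) bNa , only
        where
        b∈B : B b
        b∈B = decidable-stable (B? b) λ b∉B → ¬meets λ b∈B → contradiction b∈B b∉B

        only : ∀ q → q ∈ P → N b q → q ≡ p
        only q q∈P bNq = decidable-stable (q ≟ p) λ q≢p →
          ¬meets λ _ → q , x∈p∧x≢y⇒x∈p-y q∈P q≢p , bNq

        a   = proj₁ (hits b b∈B)
        a∈P = proj₁ (proj₂ (hits b b∈B))
        bNa = proj₂ (proj₂ (hits b b∈B))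

  irredundant-transversal : (∀ b → B b → ∃ (N b)) →
                            ∃[ P ] (Transversal P × Irredundant P)
  irredundant-transversal nonempty =
    shrink ⊤ (⊂-wellFounded ⊤) λ b b∈B → map₂ (∈⊤ ,_) (nonempty b b∈B)

-- Serving one antichain from another with three colours.

Antichain : ∀ {n} → Rel (Fin n) 0ℓ → Pred (Fin n) 0ℓ → Set
Antichain _⊏_ A = ∀ {u v} → A u → A v → ¬ u ⊏ v

UniquelyColoured : ∀ {n} {C : Set} → (Fin n → C) → Pred (Fin n) 0ℓ → Set
UniquelyColoured h N = ∃[ u ] (N u × (∀ w → N w → h w ≡ h u → w ≡ u))

private
  -- The first flag stands for membership in the transversal, the second for position parity, which
  -- is ignored off the transversal.
  mark : Bool → Bool → Fin 3
  mark false _     = zero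
  mark true  false = suc zero
  mark true  true  = suc (suc zero)

  mark-injective : ∀ {b} c {d} → mark c d ≡ mark true b → c ≡ true × d ≡ b
  mark-injective {false} true {false} _ = refl , refl
  mark-injective {true}  true {true}  _ = refl , refl
  mark-injective {false} true {true}  ()
  mark-injective {true}  true {false} ()
  mark-injective {false} false        ()
  mark-injective {true}  false        ()

  does-true : ∀ {P : Set} (P? : Dec P) → does P? ≡ true → P
  does-true (yes p) _ = p

≮-<-trans : ∀ {n} {_<_ : Rel (Fin n) 0ℓ} → IsStrictTotalOrder _≡_ _<_ →
            ∀ {x y z} → ¬ x < y → x < z → y < z
≮-<-trans sto {x} {y} x≮y x<z with IsStrictTotalOrder.compare sto x y
... | tri< x<y _ _  = contradiction x<y x≮y
... | tri≈ _ refl _ = x<z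
... | tri> _ _ y<x  = IsStrictTotalOrder.trans sto y<x x<z

module _ {n} {_<₁_ _<₂_ : Rel (Fin n) 0ℓ}
         (sto₁ : IsStrictTotalOrder _≡_ _<₁_) (sto₂ : IsStrictTotalOrder _≡_ _<₂_) where
  private
    module O₁ = IsStrictTotalOrder sto₁
    module O₂ = IsStrictTotalOrder sto₂

  infix 4 _⊏_
  _⊏_ : Rel (Fin n) 0ℓ
  u ⊏ v = u <₁ v × u <₂ v

  ⊏-isStrictPartialOrder : IsStrictPartialOrder _≡_ _⊏_
  ⊏-isStrictPartialOrder = Intersection.isStrictPartialOrderˡ
    O₁.isStrictPartialOrder O₂.trans O₂.<-resp-≈

  _⊏?_ : B.Decidable _⊏_
  u ⊏? v = u O₁.<? v ×-dec u O₂.<? v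

  module _ {A B : Pred (Fin n) 0ℓ} (A? : Decidable A) (B? : Decidable B)
           (A-antichain : Antichain _⊏_ A) (B-antichain : Antichain _⊏_ B)
           (below : ∀ b → B b → ∃[ a ] (A a × a ⊏ b)) where

    private
      -- Each missing point yields one coordinate of `b′ ⊏ b`. As `p` is before `b′` in the first
      -- order, it is not so in the second, which puts `b′` before `b` there. In the second order
      -- the antichain `A` puts `q` before `s`, hence before `b′`; so `q` is not before `b′` in the
      -- first, which puts `b′` before `b` there.
      three-hits-impossible : ∀ {p s q b b′} → A s → A q → B b → B b′ →
        p <₁ s → s <₁ q → p ⊏ b → q ⊏ b → s ⊏ b′ → ¬ p ⊏ b′ → ¬ q ⊏ b′ → ⊥
      three-hits-impossible s∈A q∈A b∈B b′∈B p<s s<q (_ , p<₂b) (q<₁b , _)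
                            (s<₁b′ , s<₂b′) p⋢b′ q⋢b′ =
        B-antichain b′∈B b∈B (b′<₁b , b′<₂b)
        where
        b′<₂b = ≮-<-trans sto₂ (λ p<₂b′ → p⋢b′ (O₁.trans p<s s<₁b′ , p<₂b′)) p<₂b
        q<₂b′ = ≮-<-trans sto₂ (λ s<₂q → A-antichain s∈A q∈A (s<q , s<₂q)) s<₂b′
        b′<₁b = ≮-<-trans sto₁ (λ q<₁b′ → q⋢b′ (q<₁b′ , q<₂b′)) q<₁b

    three-colours-suffice :
      ∃[ h ] (∀ b → B b → UniquelyColoured {C = Fin 3} h (λ a → A a × a ⊏ b))
    three-colours-suffice
      with P , hits , irredundant ←
        irredundant-transversal B? (λ b a → A? a ×-dec a ⊏? b) below
      = h , unique
      where
      position : Fin n → Bool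
      position = position-parity sto₁ P

      h : Fin n → Fin 3
      h v = mark (does (v ∈? P)) (position v)

      no-repeat : ∀ {b p q} → B b → p ∈ P → A p → A q → p ⊏ b → q ⊏ b →
                  q ∈ P → position q ≡ position p → ¬ p <₁ q
      no-repeat b∈B p∈P p∈A q∈A p⊏b q⊏b q∈P same p<q
        with s , s∈P , p<s , s<q ← position-parity-alternates sto₁ P p∈P p<q same
        -- The private `b′` of `s` misses `p` and `q`, since both differ from `s`.
        with b′ , b′∈B , (s∈A , s⊏b′) , only ← irredundant s s∈P
        = three-hits-impossible s∈A q∈A b∈B b′∈B p<s s<q p⊏b q⊏b s⊏b′
            (λ p⊏b′ → O₁.irrefl (only _ p∈P (p∈A , p⊏b′)) p<s)
            (λ q⊏b′ → O₁.irrefl (sym (only _ q∈P (q∈A , q⊏b′))) s<q)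

      unique : ∀ b → B b → UniquelyColoured h (λ a → A a × a ⊏ b)
      unique b b∈B with p , p∈P , p∈A , p⊏b ← hits b b∈B =
        p , (p∈A , p⊏b) , only-p
        where
        only-p : ∀ q → A q × q ⊏ b → h q ≡ h p → q ≡ p
        only-p q (q∈A , q⊏b) hq≡hp
          -- The colour of `p` occurs only on `P`, so `q` lies in `P` and has the parity of `p`.
          with marked , same ← mark-injective (does (q ∈? P))
                 (trans hq≡hp (cong (λ c → mark c (position p)) (dec-true (p ∈? P) p∈P)))
          with q∈P ← does-true (q ∈? P) marked
          with O₁.compare q p
        ... | tri< q<p _ _ =
          contradiction q<p (no-repeat b∈B q∈P q∈A p∈A q⊏b p⊏b p∈P (sym same))
        ... | tri≈ _ q≡p _ = q≡p
        ... | tri> _ _ p<q =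
          contradiction p<q (no-repeat b∈B p∈P p∈A q∈A p⊏b q⊏b q∈P same)

UniquelyColoured-resp : ∀ {n} {C : Set} {h : Fin n → C} {M N : Pred (Fin n) 0ℓ} →
  (∀ {u} → M u → N u) → (∀ {u} → N u → M u) →
  UniquelyColoured h M → UniquelyColoured h N
UniquelyColoured-resp to from (u , u∈M , only) = u , to u∈M , λ w → only w ∘ from

-- Ranks in a finite poset and the classes built from them.

module Height {n} {_⊏_ : Rel (Fin n) 0ℓ} (spo : IsStrictPartialOrder _≡_ _⊏_)
              (_⊏?_ : B.Decidable _⊏_) where
  open IsStrictPartialOrder spo using () renaming (trans to ⊏-trans)

  Height≥ : ℕ → Pred (Fin n) 0ℓ
  Height≥ zero    v = Unit
  Height≥ (suc k) v = ∃[ u ] (u ⊏ v × Height≥ k u)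

  height≥? : ∀ k → Decidable (Height≥ k)
  height≥? zero    v = yes tt
  height≥? (suc k) v = any? λ u → (u ⊏? v) ×-dec height≥? k u

  Height≥-mono : ∀ {i j} → i ≤ j → ∀ {v} → Height≥ j v → Height≥ i v
  Height≥-mono z≤n       _             = tt
  Height≥-mono (s≤s i≤j) (u , u⊏v , h) = u , u⊏v , Height≥-mono i≤j h

  -- Turns nested witnesses into an indexed chain, ready for the pigeonhole principle; fixing its
  -- top at `v` lets the recursion prepend.
  Height≥⇒chain : ∀ k {v} → Height≥ k v →
    Σ (Fin (suc k) → Fin n) λ f → f zero ≡ v × (∀ i j → i Fin.< j → f j ⊏ f i)
  Height≥⇒chain zero    {v} _ = (λ _ → v) , refl , λ { zero zero () }
  Height≥⇒chain (suc k) {v} (u , u⊏v , h)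
    with f , refl , descending ← Height≥⇒chain k h
    = g , refl , g-descending
    where
    g : Fin (suc (suc k)) → Fin n
    g zero    = v
    g (suc i) = f i

    f⊏v : ∀ j → f j ⊏ v
    f⊏v zero    = u⊏v
    f⊏v (suc j) = ⊏-trans (descending zero (suc j) z<s) u⊏v

    g-descending : ∀ i j → i Fin.< j → g j ⊏ g i
    g-descending zero    (suc j) _         = f⊏v j
    g-descending (suc i) (suc j) (s<s i<j) = descending i j i<j

  Rank : ℕ → Pred (Fin n) 0ℓ
  Rank k v = Height≥ k v × ¬ Height≥ (suc k) v

  rank? : ∀ k → Decidable (Rank k)
  rank? k v = height≥? k v ×-dec ¬? (height≥? (suc k) v)

  rank-below : ∀ k {v} → ¬ Height≥ k v → ∃[ r ] (r < k × Rank r v)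
  rank-below zero        low = contradiction tt low
  rank-below (suc k) {v} low with height≥? k v
  ... | yes h = k , n<1+n k , h , low
  ... | no ¬h with r , r<k , rank ← rank-below k ¬h = r , m<n⇒m<1+n r<k , rank

  Rank-unique : ∀ {i j v} → Rank i v → Rank j v → i ≡ j
  Rank-unique {i} {j} (hᵢ , lowᵢ) (hⱼ , lowⱼ) with <-cmp i j
  ... | tri< i<j _ _ = contradiction (Height≥-mono i<j hⱼ) lowᵢ
  ... | tri≈ _ i≡j _ = i≡j
  ... | tri> _ _ j<i = contradiction (Height≥-mono j<i hᵢ) lowⱼ

  Rank-antichain : ∀ k → Antichain _⊏_ (Rank k)
  Rank-antichain k {u} (h , _) (_ , low) u⊏v = low (u , u⊏v , h)

  -- A lower neighbour of height above `k` would lift `v` above height `k + 1`.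
  Rank-pred : ∀ {k v} → Rank (suc k) v → ∃[ u ] (u ⊏ v × Rank k u)
  Rank-pred ((u , u⊏v , h) , low) = u , u⊏v , h , λ h′ → low (u , u⊏v , h′)

  NonMaximal : Pred (Fin n) 0ℓ
  NonMaximal v = ∃[ w ] v ⊏ w

  nonMaximal? : Decidable NonMaximal
  nonMaximal? v = any? (v ⊏?_)

  maximal-above : ∀ v → NonMaximal v → ∃[ w ] (¬ NonMaximal w × v ⊏ w)
  maximal-above v = go v (spo-noetherian spo v)
    where
    go : ∀ v → Acc (flip _⊏_) v → NonMaximal v → ∃[ w ] (¬ NonMaximal w × v ⊏ w)
    go v (acc rec) (w , v⊏w) with nonMaximal? w
    ... | no maximal = w , maximal , v⊏w
    ... | yes nonMaximal with x , maximal , w⊏x ← go w (rec v⊏w) nonMaximal =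
      x , maximal , ⊏-trans v⊏w w⊏x

  module Classes (m : ℕ) where

    Class : Fin (suc m) → Pred (Fin n) 0ℓ
    Class zero    v = ¬ NonMaximal v
    Class (suc r) v = NonMaximal v × Rank (toℕ r) v

    class? : ∀ i → Decidable (Class i)
    class? zero    v = ¬? (nonMaximal? v)
    class? (suc r) v = nonMaximal? v ×-dec rank? (toℕ r) v

    class-of : (∀ v → ¬ Height≥ (suc m) v) → ∀ v → ∃[ i ] Class i v
    class-of bounded v with nonMaximal? v
    ... | no maximal = zero , maximal
    ... | yes nonMaximal@(w , v⊏w)
      -- A non-maximal vertex of height `m` would put `w` above the bound. So non-maximal vertices
      -- use only `m` ranks, which leaves one class for the maximal ones.
      with r , r<m , rank ← rank-below m {v} (λ h → bounded w (v , v⊏w , h))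
      = suc (fromℕ< r<m) , nonMaximal , subst (λ k → Rank k v) (sym (toℕ-fromℕ< r<m)) rank

    Class-unique : ∀ i j {v} → Class i v → Class j v → i ≡ j
    Class-unique zero    zero    _                _                = refl
    Class-unique zero    (suc s) maximal          (nonMaximal , _) = contradiction nonMaximal maximal
    Class-unique (suc r) zero    (nonMaximal , _) maximal          = contradiction nonMaximal maximal
    Class-unique (suc r) (suc s) (_ , rank)       (_ , rank′)      =
      cong suc (toℕ-injective (Rank-unique rank rank′))

    Class-antichain : ∀ i → Antichain _⊏_ (Class i)
    Class-antichain zero    {v = v} maximal _  u⊏v = maximal (v , u⊏v)
    Class-antichain (suc r) (_ , rank) (_ , rank′) = Rank-antichain (toℕ r) rank rank′

    -- The vertices for which a class is responsible. Class `suc r` consists of vertices of rank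
    -- `r`, hence the shift by one.
    Served : Fin (suc m) → Pred (Fin n) 0ℓ
    Served zero    v = NonMaximal v × Rank 0 v
    Served (suc r) v = Rank (suc (toℕ r)) v

    served-by : (∀ v → ¬ Height≥ (suc m) v) →
                ∀ {u v} → v ⊏ u ⊎ u ⊏ v → ∃[ i ] Served i v
    served-by bounded {u} {v} comparable with rank-below (suc m) (bounded v)
    ... | suc r , s<s r<m , rank =
      suc (fromℕ< r<m) , subst (λ k → Rank (suc k) v) (sym (toℕ-fromℕ< r<m)) rank
    -- A vertex of rank zero has nothing below it, so its comparable partner is above it.
    served-by _ {u} (inj₁ v⊏u) | zero , _ , rank      = zero , (u , v⊏u) , rank
    served-by _ {u} (inj₂ u⊏v) | zero , _ , (_ , low) = contradiction (u , u⊏v , tt) low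

-- Three colours inside each class.

module _ {n} {_<₁_ _<₂_ : Rel (Fin n) 0ℓ}
  (sto₁ : IsStrictTotalOrder _≡_ _<₁_) (sto₂ : IsStrictTotalOrder _≡_ _<₂_) (m : ℕ) where

  private
    _⊏′_ : Rel (Fin n) 0ℓ
    _⊏′_ = _⊏_ sto₁ sto₂

  open Height (⊏-isStrictPartialOrder sto₁ sto₂) (_⊏?_ sto₁ sto₂)
  open Classes m

  -- Comparability reduces to one direction: nothing lies above a maximal element, and no vertex of
  -- rank `r` lies above one of rank `r + 1`.
  serve-class : ∀ i → ∃[ h ] (∀ v → Served i v →
    UniquelyColoured {C = Fin 3} h (λ u → Class i u × (v ⊏′ u ⊎ u ⊏′ v)))
  serve-class zero = map₂
    (λ serves v served → UniquelyColoured-resp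
      (λ (maximal , v⊏u) → maximal , inj₁ v⊏u)
      (λ { (maximal , inj₁ v⊏u) → maximal , v⊏u
         ; (maximal , inj₂ u⊏v) → contradiction (v , u⊏v) maximal })
      (serves v served))
    -- Maximal elements lie above the vertices they serve, so both orders are reversed.
    (three-colours-suffice (Flip.isStrictTotalOrder sto₁) (Flip.isStrictTotalOrder sto₂)
      (class? zero) (λ v → nonMaximal? v ×-dec rank? 0 v)
      (λ u∈M v∈M → Class-antichain zero v∈M u∈M)
      (λ (_ , rank) (_ , rank′) → Rank-antichain 0 rank′ rank)
      (λ v (nonMaximal , _) → maximal-above v nonMaximal))
  serve-class (suc r) = map₂
    (λ serves v served → UniquelyColoured-resp
      (λ (class , u⊏v) → class , inj₂ u⊏v)
      (λ { (class , inj₂ u⊏v) → class , u⊏v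
         ; ((_ , _ , low) , inj₁ v⊏u) → contradiction
             (v , v⊏u , Height≥-mono (n≤1+n _) (proj₁ served)) low })
      (serves v served))
    (three-colours-suffice sto₁ sto₂ (class? (suc r)) (rank? (suc (toℕ r)))
      (Class-antichain (suc r)) (Rank-antichain (suc (toℕ r)))
      λ v served → let u , u⊏v , rank = Rank-pred served in
        u , ((v , u⊏v) , rank) , u⊏v)

-- Refining a proper colouring class by class.

module _ (G : Graph) {k l} (class : Coloring G k) (part : Fin k → Coloring G l) where
  open Graph G

  private
    colour : Coloring G (l * k)
    colour v = combine (part (class v) v) (class v)

    colour-injective : ∀ u v → colour u ≡ colour v →
                       part (class u) u ≡ part (class v) v × class u ≡ class v
    colour-injective u v =
      combine-injective (part (class u) u) (class u) (part (class v) v) (class v)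

  -- The class is a coordinate of the colour, so properness is inherited, and a colour seen once
  -- within a class is seen once overall.
  split-classes : IsProper G class →
    (∀ v → NonIsolated G v →
      ∃[ i ] UniquelyColoured (part i) (λ u → class u ≡ i × Adj v u)) →
    PCFColorable G (l * k)
  split-classes proper serves =
    colour , (λ u v u~v → proper u v u~v ∘ proj₂ ∘ colour-injective u v) , conflictFree
    where
    conflictFree : IsConflictFree G colour
    conflictFree v v-nonIsolated
      with _ , u , (refl , v~u) , only ← serves v v-nonIsolated
      = colour u , u , (v~u , refl) , unique
      where
      unique : ∀ {x} → Adj v x × colour x ≡ colour u → u ≡ x
      unique {x} (v~x , same) with same-part , same-class ← colour-injective x u same =
        sym (only x (same-class , v~x)
          (subst (λ i → part i x ≡ part (class u) u) same-class same-part))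

-- The bound for comparability graphs of two strict linear orders.

module _ (G : Graph) {_<₁_ _<₂_ : Rel (Graph.Vertex G) 0ℓ}
  (sto₁ : IsStrictTotalOrder _≡_ _<₁_) (sto₂ : IsStrictTotalOrder _≡_ _<₂_)
  (comparability : ∀ {u v} →
    Graph.Adj G u v ⇔ (_⊏_ sto₁ sto₂ u v ⊎ _⊏_ sto₁ sto₂ v u)) where

  open Graph G

  private
    _⊏′_ : Rel Vertex 0ℓ
    _⊏′_ = _⊏_ sto₁ sto₂

  open Height (⊏-isStrictPartialOrder sto₁ sto₂) (_⊏?_ sto₁ sto₂)

  ⊏⇒adj : ∀ {u v} → u ⊏′ v → Adj u v
  ⊏⇒adj = Equivalence.from comparability ∘ inj₁

  -- A chain is a clique, so among `k + 1` of its elements two adjacent ones would share a colour.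
  colorable⇒bounded : ∀ k → Colorable G k → ∀ v → ¬ Height≥ k v
  colorable⇒bounded k (c , proper) v h
    with f , _ , descending ← Height≥⇒chain k h
    with i , j , i<j , same ← pigeonhole (n<1+n k) (c ∘ f)
    = proper (f j) (f i) (⊏⇒adj (descending i j i<j)) (sym same)

  colorable⇒pcfColorable : ∀ k → Colorable G k → PCFColorable G (3 * k)
  -- Without colours there are no vertices, and `3 * 0` computes to `0`.
  colorable⇒pcfColorable zero    (c , proper) = c , proper , λ v _ → contradiction (c v) λ ()
  colorable⇒pcfColorable (suc m) colorable =
    split-classes G class (λ i → proj₁ (serve-class sto₁ sto₂ m i)) class-proper serves
    where
    open Classes m

    bounded : ∀ v → ¬ Height≥ (suc m) v
    bounded = colorable⇒bounded (suc m) colorable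

    class : Vertex → Fin (suc m)
    class v = proj₁ (class-of bounded v)

    in-class : ∀ {i} v → class v ≡ i → Class i v
    in-class v refl = proj₂ (class-of bounded v)

    class-proper : IsProper G class
    class-proper u v u~v same = separate (Equivalence.to comparability u~v)
      where
      separate : ¬ (u ⊏′ v ⊎ v ⊏′ u)
      separate (inj₁ u⊏v) = Class-antichain (class v) (in-class u same) (in-class v refl) u⊏v
      separate (inj₂ v⊏u) = Class-antichain (class v) (in-class v refl) (in-class u same) v⊏u

    serves : ∀ v → NonIsolated G v → ∃[ i ] UniquelyColoured
      (proj₁ (serve-class sto₁ sto₂ m i)) (λ u → class u ≡ i × Adj v u)
    serves v (w , v~w) = map₂
      (λ {i} served → UniquelyColoured-resp
        (λ {u} (u∈i , comparable) →
          Class-unique (class u) i (in-class u refl) u∈i ,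
          Equivalence.from comparability comparable)
        (λ {u} (u≡i , v~u) → in-class u u≡i , Equivalence.to comparability v~u)
        (proj₂ (serve-class sto₁ sto₂ m i) v served))
      (served-by bounded (Equivalence.to comparability v~w))

theorem1p4 : (G : Graph) → IsPermutationGraph G → χ-pcf G ≤ 3 * χ G
theorem1p4 G (_⊑_ , _ , (L , total , realizes) , comparability) =
  proj₂ (proj₂ (χ-pcf-least G)) (3 * χ G)
    (colorable⇒pcfColorable G (sto zero) (sto (suc zero)) (mk⇔ to from)
      (χ G) (proj₁ (proj₂ (χ-least G))))
  where
  open Graph G

  -- For distinct vertices, being below in both linear orders is the same as being strictly below in
  -- both.
  sto : ∀ i → IsStrictTotalOrder _≡_ (ToStrict._<_ _≡_ (L i))
  sto i = ToStrict.<-isStrictTotalOrder₁ _≡_ (L i) _≟_ (total i)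

  _⊏′_ : Rel Vertex 0ℓ
  _⊏′_ = _⊏_ (sto zero) (sto (suc zero))

  ⊑⇒⊏ : ∀ {u v} → u ≢ v → u ⊑ v → u ⊏′ v
  ⊑⇒⊏ {u} {v} u≢v u⊑v = (below zero , u≢v) , (below (suc zero) , u≢v)
    where below = Equivalence.to (realizes u v) u⊑v

  ⊏⇒⊑ : ∀ {u v} → u ⊏′ v → u ⊑ v
  ⊏⇒⊑ {u} {v} ((u≤₁v , _) , (u≤₂v , _)) =
    Equivalence.from (realizes u v) λ { zero → u≤₁v ; (suc zero) → u≤₂v }

  to : ∀ {u v} → Adj u v → u ⊏′ v ⊎ v ⊏′ u
  to {u} {v} u~v with Equivalence.to (comparability u v) u~v
  ... | u≢v , inj₁ u⊑v = inj₁ (⊑⇒⊏ u≢v u⊑v)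
  ... | u≢v , inj₂ v⊑u = inj₂ (⊑⇒⊏ (u≢v ∘ sym) v⊑u)

  from : ∀ {u v} → u ⊏′ v ⊎ v ⊏′ u → Adj u v
  from {u} {v} (inj₁ u⊏v@((_ , u≢v) , _)) =
    Equivalence.from (comparability u v) (u≢v , inj₁ (⊏⇒⊑ u⊏v))
  from {u} {v} (inj₂ v⊏u@((_ , v≢u) , _)) =
    Equivalence.from (comparability u v) (v≢u ∘ sym , inj₂ (⊏⇒⊑ v⊏u))
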